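{- The mesh patterns $$m_1=(12,\{(0,1),(0,2),(2,0),(2,1)\})\quad\text{and}\quad m_2=(12,\{(0,1),(0,2),(1,1),(2,0),(2,1)\})$$ are coincident under $321$, i.e. $\mathrm{Av}(\{321,m_1\})=\mathrm{Av}(\{321,m_2\})$.
   Context: Write $[n]=\{1,\dots,n\}$. A permutation of length $n$ is a bijection of $[n]$, written in one-line notation; $G(\pi)=\{(i,\pi(i)) : i\in[n]\}$ is its plot. A mesh pattern of length $k$ is a pair $p=(\tau,R)$ with $\tau$ a permutation of length $k$ and $R\subseteq\{0,\dots,k\}^2$. An occurrence of $p$ in a permutation $\pi$ of length $n$ is a subset $\omega\subseteq G(\pi)$ for which there are order-preserving injections $\alpha,\beta:[k]\to[n]$ such that (i) $\omega=\{(\alpha(i),\beta(j)):(i,j)\in G(\tau)\}$, and (ii) with $\alpha(0)=\beta(0)=0$, $\alpha(k+1)=\beta(k+1)=n+1$ and $R_{ij}=[\alpha(i)+1,\alpha(i+1)-1]\times[\beta(j)+1,\beta(j+1)-1]$, one has $R_{ij}\cap G(\pi)=\emptyset$ for every $(i,j)\in R$. A permutation avoids $p$ if it has no occurrence of $p$. A classical pattern $\pi$ is identified with the mesh pattern $(\pi,\emptyset)$. $\mathrm{Av}(S)$ is the set of all permutations (of all lengths) avoiding every pattern in $S$. -}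

module Defs where

open import Data.Fin using (Fin; _≤_; toℕ; suc; inject₁)
open import Data.Fin.Patterns using (0F; 1F; 2F)
open import Data.Fin.Permutation using (Permutation′; _⟨$⟩ʳ_; id; reverse)
open import Data.List using ([]; _∷_)
import Data.List.Membership.Propositional as List
open import Data.Nat using (ℕ; _<_) renaming (suc to 1+_)
open import Data.Product using (_×_; _,_; ∃; ∃₂)
open import Data.Vec using (_∷_; _∷ʳ_; tabulate; lookup)
open import Function using (_∘_)
open import Function.Definitions using (Injective)
open import Level using (Level; 0ℓ; _⊔_) renaming (suc to lsuc)
open import Relation.Binary using (_Preserves_⟶_)
open import Relation.Binary.PropositionalEquality using (_≡_)
open import Relation.Nullary using (¬_)
open import Relation.Unary using (Pred; _∈_; _⊆_; _∩_; ∅; Empty; _≐_)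

-- [n] is represented by Fin n, so x : Fin n stands for the number toℕ x + 1.

Perm : Set
Perm = ∃ Permutation′

Plot : ∀ {n} → Permutation′ n → Pred (Fin n × Fin n) 0ℓ
Plot π (x , y) = π ⟨$⟩ʳ x ≡ y

record MeshPattern : Set₁ where
  constructor mesh
  field
    {size}  : ℕ
    τ       : Permutation′ size
    shading : Pred (Fin (1+ size) × Fin (1+ size)) 0ℓ

classical : ∀ {k} → Permutation′ k → MeshPattern
classical τ = mesh τ ∅

OrderPreservingInjection : ∀ {k n} → (Fin k → Fin n) → Set
OrderPreservingInjection α = Injective _≡_ _≡_ α × α Preserves _≤_ ⟶ _≤_

-- The 1-based values α(0) = 0, α(1), …, α(k), α(k+1) = n + 1.
extend : ∀ {k n} → (Fin k → Fin n) → Fin (1+ (1+ k)) → ℕ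
extend {n = n} α = lookup (0 ∷ (tabulate (1+_ ∘ toℕ ∘ α) ∷ʳ 1+ n))

-- x ∈ [α(i) + 1 , α(i+1) - 1]
Between : ∀ {k n} → (Fin k → Fin n) → Fin (1+ k) → Pred (Fin n) 0ℓ
Between α i x =
  extend α (inject₁ i) < 1+ (toℕ x) × 1+ (toℕ x) < extend α (suc i)

Box : ∀ {k n} (α β : Fin k → Fin n) → Fin (1+ k) × Fin (1+ k) →
      Pred (Fin n × Fin n) 0ℓ
Box α β (i , j) (x , y) = x ∈ Between α i × y ∈ Between β j

PatternImage : ∀ {k n} → Permutation′ k → (α β : Fin k → Fin n) →
               Pred (Fin n × Fin n) 0ℓ
PatternImage τ α β pt = ∃₂ λ i j → (i , j) ∈ Plot τ × pt ≡ (α i , β j)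

IsOccurrence : ∀ {n} → MeshPattern → Permutation′ n →
               Pred (Fin n × Fin n) 0ℓ → Set
IsOccurrence {n} (mesh {k} τ R) π ω =
  ω ⊆ Plot π ×
  ∃₂ λ (α β : Fin k → Fin n) →
    OrderPreservingInjection α ×
    OrderPreservingInjection β ×
    ω ≐ PatternImage τ α β ×
    (∀ c → c ∈ R → Empty (Box α β c ∩ Plot π))

Avoids : ∀ {n} → Permutation′ n → MeshPattern → Set₁
Avoids π p = ∀ ω → ¬ IsOccurrence p π ω

Av : ∀ {ℓ : Level} → Pred MeshPattern ℓ → Pred Perm (lsuc 0ℓ ⊔ ℓ)
Av S (n , π) = ∀ p → p ∈ S → Avoids π p

π12 : Permutation′ 2
π12 = id

π321 : Permutation′ 3
π321 = reverse

m₁ : MeshPattern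
m₁ = mesh π12 (List._∈ ((0F , 1F) ∷ (0F , 2F) ∷ (2F , 0F) ∷ (2F , 1F) ∷ []))

m₂ : MeshPattern
m₂ = mesh π12
  (List._∈ ((0F , 1F) ∷ (0F , 2F) ∷ (1F , 1F) ∷ (2F , 0F) ∷ (2F , 1F) ∷ []))

-- An occurrence of m₁ is a left-to-right maximum a together with a
-- right-to-left minimum b lying above and to the right of a; for m₂ the box
-- between a and b must also be empty.  In a 321-avoiding permutation every
-- point is a left-to-right maximum or a right-to-left minimum, so a point c
-- inside that box can replace a or b, and the box shrinks.

{-# OPTIONS --safe #-}
module Submission where

open import Defs
open import Data.Fin using (Fin; _<_; _≤_; _>_)
open import Data.Fin.Induction using (<-wellFounded; >-wellFounded)
open import Data.Fin.Patterns using (0F; 1F; 2F)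
open import Data.Fin.Permutation using (Permutation′; _⟨$⟩ʳ_)
open import Data.Fin.Properties using (<-cmp; <-trans; <-asym; <-irrefl; ≤∧≢⇒<; toℕ<n)
open import Data.List.Relation.Unary.Any using (here; there)
open import Data.Nat using (z<s; s<s; s<s⁻¹)
import Data.Nat.Properties as ℕ
open import Data.Product using (_×_; _,_; ∃₂)
open import Data.Sum using (inj₁; inj₂)
open import Data.Vec using (lookup; _∷_; [])
open import Function using (id; Injection)
open import Function.Properties.Inverse using (↔⇒↣)
open import Induction.WellFounded using (Acc; acc)
open import Relation.Binary using (_Preserves_⟶_; tri<; tri≈; tri>)
open import Relation.Binary.PropositionalEquality using (_≡_; refl; sym; trans; subst)
open import Relation.Nullary using (¬_; contradiction)
open import Relation.Unary using (Pred; _≐_; _∪_; ｛_｝; _⊆_; _∈_; _∩_; Empty)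

module _ {k n} {α : Fin k → Fin n} where

  -- Lets occurrences be built from `<` alone; trichotomy on the indices yields both injectivity and
  -- weak monotonicity.
  strict⇒orderPreserving : α Preserves _<_ ⟶ _<_ → OrderPreservingInjection α
  strict⇒orderPreserving mono = injective , monotone
    where
    injective : ∀ {i j} → α i ≡ α j → i ≡ j
    injective {i} {j} eq with <-cmp i j
    ... | tri< i<j _ _ = contradiction (mono i<j) (<-irrefl eq)
    ... | tri≈ _ i≡j _ = i≡j
    ... | tri> _ _ j<i = contradiction (mono j<i) (<-irrefl (sym eq))

    monotone : α Preserves _≤_ ⟶ _≤_
    monotone {i} {j} i≤j with <-cmp i j
    ... | tri< i<j _ _   = ℕ.<⇒≤ (mono i<j)
    ... | tri≈ _ refl _  = ℕ.≤-refl
    ... | tri> _ _ j<i   = contradiction i≤j (ℕ.<⇒≱ j<i)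

  orderPreserving⇒strict : OrderPreservingInjection α → α Preserves _<_ ⟶ _<_
  orderPreserving⇒strict (injective , monotone) i<j =
    ≤∧≢⇒< (monotone (ℕ.<⇒≤ i<j)) (λ eq → <-irrefl (injective eq) i<j)

lookup-pair-mono : ∀ {n} {a b : Fin n} → a < b →
                   lookup (a ∷ b ∷ []) Preserves _<_ ⟶ _<_
lookup-pair-mono a<b {0F} {1F} _ = a<b
lookup-pair-mono a<b {1F} {1F} (s<s ())

lookup-triple-mono : ∀ {n} {a b c : Fin n} → a < b → b < c →
                     lookup (a ∷ b ∷ c ∷ []) Preserves _<_ ⟶ _<_
lookup-triple-mono a<b b<c {0F} {1F} _ = a<b
lookup-triple-mono a<b b<c {0F} {2F} _ = <-trans a<b b<c
lookup-triple-mono a<b b<c {1F} {2F} _ = b<c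
lookup-triple-mono a<b b<c {1F} {1F} (s<s ())
lookup-triple-mono a<b b<c {2F} {1F} (s<s ())
lookup-triple-mono a<b b<c {2F} {2F} (s<s (s<s ()))

-- Shading more boxes only adds emptiness conditions, so every occurrence for `R′` is also one for
-- `R`.
avoids-antitone : ∀ {k n} {τ : Permutation′ k} {R R′} {π : Permutation′ n} →
                  R ⊆ R′ → Avoids π (mesh τ R) → Avoids π (mesh τ R′)
avoids-antitone R⊆R′ avoids ω (ω⊆π , α , β , α↑ , β↑ , ω≐ , empty) =
  avoids ω (ω⊆π , α , β , α↑ , β↑ , ω≐ , λ c c∈R → empty c (R⊆R′ c∈R))

module _ {n} (π : Permutation′ n) where

  LRMax : Pred (Fin n) _
  LRMax i = ∀ {j} → j < i → ¬ (π ⟨$⟩ʳ i < π ⟨$⟩ʳ j)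

  RLMin : Pred (Fin n) _
  RLMin i = ∀ {j} → i < j → ¬ (π ⟨$⟩ʳ j < π ⟨$⟩ʳ i)

  -- Taking the occurrence to be the pattern image itself makes the required equality of sets
  -- trivial.
  patternImage-occurrence :
    ∀ {k} (τ : Permutation′ k) {R} {α β : Fin k → Fin n} →
    α Preserves _<_ ⟶ _<_ → β Preserves _<_ ⟶ _<_ →
    (∀ i → π ⟨$⟩ʳ α i ≡ β (τ ⟨$⟩ʳ i)) →
    (∀ c → c ∈ R → Empty (Box α β c ∩ Plot π)) →
    IsOccurrence (mesh τ R) π (PatternImage τ α β)
  patternImage-occurrence τ α↑ β↑ image empty =
    (λ { (i , _ , refl , refl) → image i }) ,
    _ , _ , strict⇒orderPreserving α↑ , strict⇒orderPreserving β↑ ,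
    (id , id) , empty

  avoids-321 : Avoids π (classical π321) → ∀ {a b c} → a < b → b < c →
               π ⟨$⟩ʳ b < π ⟨$⟩ʳ a → ¬ (π ⟨$⟩ʳ c < π ⟨$⟩ʳ b)
  avoids-321 avoids {a} {b} {c} a<b b<c πb<πa πc<πb =
    avoids _ (patternImage-occurrence π321
      -- Values are listed in increasing order, hence from `c` back to `a`; `reverse` pairs them
      -- with the positions.
      (lookup-triple-mono a<b b<c) (lookup-triple-mono πc<πb πb<πa)
      (λ { 0F → refl ; 1F → refl ; 2F → refl }) (λ _ ()))

  -- Left of `a`, the boxes (0,1) and (0,2) cover all values above that of `a` except the value of
  -- `b`. Right of `b`, the boxes (2,0) and (2,1) cover all values below that of `b` except the
  -- value of `a`.
  m₁-occurrence⇒ : ∀ {ω} → IsOccurrence m₁ π ω →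
    ∃₂ λ a b → a < b × π ⟨$⟩ʳ a < π ⟨$⟩ʳ b × LRMax a × RLMin b
  m₁-occurrence⇒ (ω⊆π , α , β , α↑ , β↑ , (_ , image⊆ω) , empty) =
    a , b , a<b , πa<πb , lrMax , rlMin
    where
    a = α 0F
    b = α 1F

    πa≡ : π ⟨$⟩ʳ a ≡ β 0F
    πa≡ = ω⊆π (image⊆ω (0F , 0F , refl , refl))

    πb≡ : π ⟨$⟩ʳ b ≡ β 1F
    πb≡ = ω⊆π (image⊆ω (1F , 1F , refl , refl))

    a<b : a < b
    a<b = orderPreserving⇒strict α↑ z<s

    πa<πb : π ⟨$⟩ʳ a < π ⟨$⟩ʳ b
    πa<πb rewrite πa≡ | πb≡ = orderPreserving⇒strict β↑ z<s

    value≡πb : ∀ {j} → π ⟨$⟩ʳ j ≡ β 1F → j ≡ b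
    value≡πb eq = Injection.injective (↔⇒↣ π) (trans eq (sym πb≡))

    value≡πa : ∀ {j} → π ⟨$⟩ʳ j ≡ β 0F → j ≡ a
    value≡πa eq = Injection.injective (↔⇒↣ π) (trans eq (sym πa≡))

    lrMax : LRMax a
    lrMax {j} j<a πa<πj with <-cmp (π ⟨$⟩ʳ j) (β 1F)
    ... | tri< πj<πb _ _ = empty (0F , 1F) (here refl) (j , _)
      (((z<s , s<s j<a) , s<s (subst (_< _) πa≡ πa<πj) , s<s πj<πb) , refl)
    -- The row of `β 1F` lies in no box, but its only point is `b`, which is to the right of `a`.
    ... | tri≈ _ eq _ = <-asym a<b (subst (_< a) (value≡πb eq) j<a)
    ... | tri> _ _ πb<πj = empty (0F , 2F) (there (here refl)) (j , _)
      (((z<s , s<s j<a) , s<s πb<πj , s<s (toℕ<n _)) , refl)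

    rlMin : RLMin b
    rlMin {j} b<j πj<πb with <-cmp (π ⟨$⟩ʳ j) (β 0F)
    ... | tri< πj<πa _ _ = empty (2F , 0F) (there (there (here refl))) (j , _)
      (((s<s b<j , s<s (toℕ<n _)) , z<s , s<s πj<πa) , refl)
    ... | tri≈ _ eq _ = <-asym a<b (subst (b <_) (value≡πa eq) b<j)
    ... | tri> _ _ πa<πj =
      empty (2F , 1F) (there (there (there (here refl)))) (j , _)
      (((s<s b<j , s<s (toℕ<n _)) , s<s πa<πj , s<s (subst (_ <_) πb≡ πj<πb)) , refl)

  -- The shaded boxes of column 0 lie left of and above `a`, so `lrMax` empties them; those of
  -- column 2 lie right of and below `b`, so `rlMin` does. The box (1,1) is `noneInside`.
  m₂-occurrence : ∀ {a b} →
    a < b → π ⟨$⟩ʳ a < π ⟨$⟩ʳ b → LRMax a → RLMin b →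
    (∀ {c} → a < c → c < b → π ⟨$⟩ʳ a < π ⟨$⟩ʳ c → ¬ (π ⟨$⟩ʳ c < π ⟨$⟩ʳ b)) →
    IsOccurrence m₂ π _
  m₂-occurrence {a} {b} a<b πa<πb lrMax rlMin noneInside =
    patternImage-occurrence π12 {α = lookup (a ∷ b ∷ [])}
      (lookup-pair-mono a<b) (lookup-pair-mono πa<πb)
      (λ { 0F → refl ; 1F → refl })
      λ { _ (here refl) _ (((_ , j<a) , πa<πj , _) , refl) →
            lrMax (s<s⁻¹ j<a) (s<s⁻¹ πa<πj)
        ; _ (there (here refl)) _ (((_ , j<a) , πb<πj , _) , refl) →
            lrMax (s<s⁻¹ j<a) (<-trans πa<πb (s<s⁻¹ πb<πj))
        ; _ (there (there (here refl))) _
            (((a<c , c<b) , πa<πc , πc<πb) , refl) →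
            noneInside (s<s⁻¹ a<c) (s<s⁻¹ c<b) (s<s⁻¹ πa<πc) (s<s⁻¹ πc<πb)
        ; _ (there (there (there (here refl)))) _
            (((b<j , _) , _ , πj<πa) , refl) →
            rlMin (s<s⁻¹ b<j) (<-trans (s<s⁻¹ πj<πa) πa<πb)
        ; _ (there (there (there (there (here refl))))) _
            (((b<j , _) , _ , πj<πb) , refl) →
            rlMin (s<s⁻¹ b<j) (s<s⁻¹ πj<πb)
        }

  -- The recursion moves either `a` to the right or `b` to the left and keeps the other endpoint
  -- with its accessibility proof, so it terminates.
  avoids-321-m₂⇒ : Avoids π (classical π321) → Avoids π m₂ →
    ∀ {a b} → Acc _>_ a → Acc _<_ b →
    a < b → π ⟨$⟩ʳ a < π ⟨$⟩ʳ b → LRMax a → ¬ RLMin b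
  avoids-321-m₂⇒ avoids₃₂₁ avoids₂ {a} {b} acc-a@(acc above) acc-b@(acc below)
    a<b πa<πb lrMax rlMin =
    avoids₂ _ (m₂-occurrence a<b πa<πb lrMax rlMin
      λ {c} a<c c<b πa<πc πc<πb →
        -- No case distinction on `c` is made: were it a right-to-left minimum, the pair `a`, `c`
        -- would contradict the induction hypothesis.
        let c-not-RLMin : ¬ RLMin c
            c-not-RLMin =
              avoids-321-m₂⇒ avoids₃₂₁ avoids₂ acc-a (below c<b) a<c πa<πc lrMax

            -- If some earlier `d` had a larger value, any later `e` with a smaller value would
            -- complete a 321 with middle entry `c`; so `c` would be a right-to-left minimum after
            -- all.
            c-LRMax : LRMax c
            c-LRMax d<c πc<πd = c-not-RLMin λ c<e πe<πc →
              avoids-321 avoids₃₂₁ d<c c<e πc<πd πe<πc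
        in avoids-321-m₂⇒ avoids₃₂₁ avoids₂ (above a<c) acc-b c<b πc<πb c-LRMax rlMin)

  avoids-321-m₂⇒m₁ : Avoids π (classical π321) → Avoids π m₂ → Avoids π m₁
  avoids-321-m₂⇒m₁ avoids₃₂₁ avoids₂ ω occ =
    let a , b , a<b , πa<πb , lrMax , rlMin = m₁-occurrence⇒ occ
    in avoids-321-m₂⇒ avoids₃₂₁ avoids₂ (>-wellFounded a) (<-wellFounded b)
         a<b πa<πb lrMax rlMin

m₁-shading⊆m₂-shading : MeshPattern.shading m₁ ⊆ MeshPattern.shading m₂
m₁-shading⊆m₂-shading (here eq) = here eq
m₁-shading⊆m₂-shading (there (here eq)) = there (here eq)
m₁-shading⊆m₂-shading (there (there rest)) = there (there (there rest))

mainTheorem12 : Av (｛ classical π321 ｝ ∪ ｛ m₁ ｝) ≐ Av (｛ classical π321 ｝ ∪ ｛ m₂ ｝)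
mainTheorem12 =
  (λ { avoids _ (inj₁ refl) → avoids _ (inj₁ refl)
     ; {_ , π} avoids _ (inj₂ refl) →
         avoids-antitone {τ = π12} {π = π} m₁-shading⊆m₂-shading (avoids _ (inj₂ refl)) }) ,
  (λ { avoids _ (inj₁ refl) → avoids _ (inj₁ refl)
     ; {_ , π} avoids _ (inj₂ refl) →
         avoids-321-m₂⇒m₁ π (avoids _ (inj₁ refl)) (avoids _ (inj₂ refl)) })
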